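{- Let $t \in \mathbb{N}$ and let $f(t)$ be an integer such that every graph not containing $K_t$ as a minor is $f(t)$-colorable. Then every graph not containing $K_t$ as an odd minor is $2f(t)$-colorable.
   Context: All graphs are finite, simple and undirected. A graph is $k$-colorable if it admits a proper vertex coloring with at most $k$ colors. Given $t \in \mathbb{N}$, a $K_t$-expansion is a graph consisting of $t$ pairwise vertex-disjoint (non-empty) trees $T_1,\ldots,T_t$ together with exactly one connecting edge between $T_s$ and $T_{s'}$ for every pair of distinct $s,s' \in \{1,\ldots,t\}$ (and no other vertices or edges). A graph contains $K_t$ as a minor if it has a subgraph (not necessarily induced) that is a $K_t$-expansion. A $K_t$-expansion $H$ certified by vertex-disjoint trees $T_1,\ldots,T_t$ is odd if there is an assignment of the two colors $\{1,2\}$ to the vertices of $H$ such that every edge contained in one of the trees $T_s$ is bichromatic (its endpoints have different colors), while every edge joining two distinct trees is monochromatic (its endpoints have the same color). A graph contains $K_t$ as an odd minor if it has a subgraph (not necessarily induced) that is an odd $K_t$-expansion. -}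

module Defs where

open import Level using (0ℓ)
open import Data.Nat using (ℕ)
open import Data.Integer using (ℤ; +_) renaming (_≤_ to _≤ᶻ_)
open import Data.Fin using (Fin)
open import Data.Fin.Subset using (Subset; _∈_; _⊆_; _∩_; Nonempty; Empty)
open import Data.List using (List; _∷_; _++_; [_])
open import Data.List.Relation.Unary.Linked using (Linked)
open import Data.List.Relation.Unary.Unique.Propositional using (Unique)
open import Data.Product using (∃; ∃-syntax; ∃!; Σ; _×_; _,_; proj₁)
open import Data.Sum using (_⊎_)
open import Relation.Binary using (Rel; Symmetric; Irreflexive; Decidable)
open import Relation.Binary.Construct.Closure.ReflexiveTransitive using (Star)
open import Relation.Binary.PropositionalEquality using (_≡_; _≢_)
open import Relation.Nullary using (¬_)

-- A finite simple graph whose vertex set V is an arbitrary subset of Fin n.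
-- Thus a graph and its subgraphs are objects of the same type, and every
-- finite graph occurs up to isomorphism.
record Graph (n : ℕ) : Set₁ where
  field
    V          : Subset n
    Adj        : Rel (Fin n) 0ℓ
    Adj?       : Decidable Adj
    Adj-sym    : Symmetric Adj
    Adj-irrefl : Irreflexive _≡_ Adj
    Adj⇒∈V     : ∀ {u v} → Adj u v → u ∈ V

  Vertex : Set
  Vertex = ∃[ v ] v ∈ V

open Graph public

infix 4 _⊆ᴳ_

_⊆ᴳ_ : ∀ {n} → Graph n → Graph n → Set
H ⊆ᴳ G = V H ⊆ V G × (∀ {u v} → Adj H u v → Adj G u v)

Proper : ∀ {n m} (G : Graph n) → (Vertex G → Fin m) → Set
Proper G c = (u v : Vertex G) → Adj G (proj₁ u) (proj₁ v) → c u ≢ c v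

-- At most k colors, for an integer k: nothing is k-colorable for negative k.
Colorable : ∀ {n} → ℤ → Graph n → Set
Colorable k G = ∃[ m ] (+ m ≤ᶻ k) × Σ (Vertex G → Fin m) (Proper G)

-- Holds vacuously of the empty graph; trees below are also required to be
-- non-empty.
Connected : ∀ {n} → Graph n → Set
Connected G = ∀ {u v} → u ∈ V G → v ∈ V G → Star (Adj G) u v

-- A cycle is a closed walk u, v, w, …, u of length at least three that
-- repeats no vertex other than its endpoint.
Acyclic : ∀ {n} → Graph n → Set
Acyclic {n} G = ∀ (u v w : Fin n) (ws : List (Fin n)) →
  Unique (u ∷ v ∷ w ∷ ws) → ¬ Linked (Adj G) (u ∷ v ∷ w ∷ ws ++ [ u ])

record IsTree {n} (T : Graph n) : Set where
  field
    nonempty  : Nonempty (V T)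
    connected : Connected T
    acyclic   : Acyclic T

record IsExpansion {n} (t : ℕ) (H : Graph n) (T : Fin t → Graph n) : Set where
  field
    trees     : ∀ s → IsTree (T s)
    disjoint  : ∀ {s s′} → s ≢ s′ → Empty (V (T s) ∩ V (T s′))
    subgraphs : ∀ s → T s ⊆ᴳ H
    -- As the trees are disjoint, edges between T s and T s′ correspond
    -- bijectively to adjacent pairs in V (T s) × V (T s′).
    connectingEdge : ∀ {s s′} → s ≢ s′ →
      ∃! {A = Fin n × Fin n} _≡_ λ (u , v) → u ∈ V (T s) × v ∈ V (T s′) × Adj H u v
    noOtherVertices : ∀ {v} → v ∈ V H → ∃[ s ] v ∈ V (T s)
    noOtherEdges : ∀ {u v} → Adj H u v →
      (∃[ s ] Adj (T s) u v) ⊎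
      (∃[ s ] ∃[ s′ ] s ≢ s′ × u ∈ V (T s) × v ∈ V (T s′))

record IsOddExpansion {n} (t : ℕ) (H : Graph n) (T : Fin t → Graph n) : Set where
  field
    isExpansion : IsExpansion t H T
    color       : Vertex H → Fin 2
    bichromatic : ∀ s (u v : Vertex H) →
      Adj (T s) (proj₁ u) (proj₁ v) → color u ≢ color v
    monochromatic : ∀ {s s′} → s ≢ s′ → (u v : Vertex H) →
      proj₁ u ∈ V (T s) → proj₁ v ∈ V (T s′) →
      Adj H (proj₁ u) (proj₁ v) → color u ≡ color v

HasMinor : ∀ {n} → ℕ → Graph n → Set₁
HasMinor t G = ∃[ H ] (H ⊆ᴳ G) × ∃[ T ] IsExpansion t H T

HasOddMinor : ∀ {n} → ℕ → Graph n → Set₁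
HasOddMinor t G = ∃[ H ] (H ⊆ᴳ G) × ∃[ T ] IsOddExpansion t H T

{-# OPTIONS --safe #-}

-- Split V(G) into classes that induce connected bipartite graphs, each with a
-- proper 2-colouring ("side"), and merge two classes whenever the edges between
-- them are all bichromatic, possibly after swapping the sides of one of them.
-- When this is no longer possible, any two adjacent classes are joined both by
-- a monochromatic and by a bichromatic edge. A K_t-expansion in the graph
-- obtained by contracting the classes then lifts to an odd one in G: use
-- bichromatic edges inside the trees and monochromatic ones between them.
-- So the contracted graph is f(t)-colourable, and pairing its colouring with
-- the side gives a 2f(t)-colouring of G.
module Submission where

open import Data.Bool using (Bool; true; false; not; if_then_else_)
open import Data.Bool.Properties using (not-¬; not-injective)
  renaming (_≟_ to _≟ᵇ_)
open import Data.Fin using (Fin; _<_; punchOut; combine)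
open import Data.Fin.Properties using
  (_≟_; _<?_; <-cmp; any?; punchOut-cong; punchOut-injective; combine-injective; 2↔Bool)
open import Data.Fin.Subset using (Subset; _∈_)
open import Data.Fin.Subset.Properties using (_∈?_; x∈p∩q⁺; x∈p∩q⁻)
open import Data.Integer using (ℤ; +_; _*_) renaming (_≤_ to _≤ᶻ_)
open import Data.Integer.Properties using (*-monoˡ-≤-nonNeg; pos-*)
open import Data.List using ([]; _∷_; _++_; [_])
import Data.List.Membership.Propositional as List
open import Data.List.Relation.Unary.All as All using ([]; _∷_)
open import Data.List.Relation.Unary.AllPairs using ([]; _∷_)
open import Data.List.Relation.Unary.Any using (here; there)
open import Data.List.Relation.Unary.Linked using (Linked; _∷_)
open import Data.List.Relation.Unary.Unique.Propositional using (Unique)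
open import Data.Maybe using (Maybe; just; nothing)
open import Data.Maybe.Properties using (just-injective; ≡-dec)
open import Data.Nat as ℕ using (ℕ; zero; suc)
import Data.Nat.Properties as ℕ
open import Data.Product using (∃; ∃-syntax; Σ-syntax; _×_; _,_; proj₁; proj₂)
open import Data.Product.Properties using () renaming (≡-dec to ×-≡-dec)
open import Data.Sum using (_⊎_; inj₁; inj₂; swap)
open import Data.Vec using (tabulate)
open import Data.Vec.Properties using (lookup∘tabulate; lookup⇒[]=; []=⇒lookup)
open import Function using (_∘_; id; const; Inverse)
open import Level using (0ℓ)
open import Relation.Binary using (Rel; Decidable; tri<; tri≈; tri>)
open import Relation.Binary.Construct.Closure.ReflexiveTransitive
  using (Star; ε; _◅_; _◅◅_; reverse) renaming (map to mapStar)
open import Relation.Binary.PropositionalEquality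
  using (_≡_; _≢_; refl; sym; trans; cong; subst; ≢-sym)
open import Relation.Nullary using (¬_; Dec; yes; no; does; contradiction)
open import Relation.Nullary.Decidable
  using (_×-dec_; _⊎-dec_; ¬?; dec-true; dec-false; decidable-stable)
import Relation.Unary as U
open import Defs

-- Decidable subsets and least witnesses.

module _ {n} {P : Fin n → Set} (P? : U.Decidable P) where

  subset : Subset n
  subset = tabulate (does ∘ P?)

  ∈-subset⁺ : ∀ {v} → P v → v ∈ subset
  ∈-subset⁺ {v} p =
    lookup⇒[]= v _ (trans (lookup∘tabulate _ v) (dec-true (P? v) p))

  ∈-subset⁻ : ∀ {v} → v ∈ subset → P v
  ∈-subset⁻ {v} v∈ = decidable-stable (P? v) λ ¬p →
    contradiction (trans (sym (dec-false (P? v) ¬p))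
      (trans (sym (lookup∘tabulate _ v)) ([]=⇒lookup v∈))) λ ()

least : {P : ℕ → Set} → U.Decidable P → ∀ {k} → P k →
        ∃[ j ] P j × (∀ {i} → P i → j ℕ.≤ i)
least {P} P? p with P? 0
... | yes p₀ = 0 , p₀ , const ℕ.z≤n
least P? {zero}  p | no ¬p₀ = contradiction p ¬p₀
least {P} P? {suc k} p | no ¬p₀ with least (P? ∘ suc) p
... | j , pⱼ , j≤ = suc j , pⱼ , bound
  where
  bound : ∀ {i} → P i → suc j ℕ.≤ i
  bound {zero}  q = contradiction q ¬p₀
  bound {suc i} q = ℕ.s≤s (j≤ q)

-- Spanning trees

module ParentFunction {n} (parent : Fin n → Maybe (Fin n)) (depth : Fin n → ℕ)
  (depth-parent : ∀ {u v} → parent v ≡ just u → depth u ℕ.< depth v) where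

  -- A step by `inj₁` descends from parent to child and a step by `inj₂` ascends. Hypotheses named
  -- `a→b` always point from parent to child.
  TreeEdge : Rel (Fin n) 0ℓ
  TreeEdge u v = parent v ≡ just u ⊎ parent u ≡ just v

  private
    unique-parent : ∀ {u v w} → parent w ≡ just u → parent w ≡ just v → u ≡ v
    unique-parent p q = just-injective (trans (sym p) q)

  -- A walk without repeated vertices keeps descending after its first step away
  -- from the root. So a cycle would descend all the way, ascend all the way, or
  -- leave and re-enter its base point through the parent of that point.
  descending-walk : ∀ {z a b} ws → Unique (z ∷ a ∷ b ∷ ws) →
    Linked TreeEdge (a ∷ b ∷ ws ++ [ z ]) → parent b ≡ just a → depth a ℕ.< depth z
  descending-walk [] _ (_ ∷ inj₁ b→z ∷ _) a→b =
    ℕ.<-trans (depth-parent a→b) (depth-parent b→z)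
  descending-walk [] ((z≢a ∷ _) ∷ _) (_ ∷ inj₂ z→b ∷ _) a→b =
    contradiction (unique-parent z→b a→b) z≢a
  descending-walk (c ∷ ws) ((_ ∷ z∉) ∷ _ ∷ uniq) (_ ∷ edges@(inj₁ b→c ∷ _)) a→b =
    ℕ.<-trans (depth-parent a→b) (descending-walk ws (z∉ ∷ uniq) edges b→c)
  descending-walk (c ∷ ws) (_ ∷ (_ ∷ a≢c ∷ _) ∷ _) (_ ∷ inj₂ c→b ∷ _) a→b =
    contradiction (unique-parent a→b c→b) a≢c

  -- Induction from the end of the walk. If the last step enters `z` from its parent, this stays
  -- true of every longer walk. Otherwise the rest of the walk ascends, and a preceding step down to
  -- `b` is impossible: the walk would leave `b` through its parent, which is `a` again, or descend
  -- all the way to `z`.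
  ascending-or-enters-from-parent : ∀ {z a b} ws → Unique (z ∷ a ∷ b ∷ ws) →
    Linked TreeEdge (a ∷ b ∷ ws ++ [ z ]) →
    depth z ℕ.< depth a ⊎ (∃[ p ] p List.∈ b ∷ ws × parent z ≡ just p)
  ascending-or-enters-from-parent [] _ (_ ∷ inj₁ b→z ∷ _) = inj₂ (_ , here refl , b→z)
  ascending-or-enters-from-parent [] ((z≢a ∷ _) ∷ _) (inj₁ a→b ∷ inj₂ z→b ∷ _) =
    contradiction (unique-parent z→b a→b) z≢a
  ascending-or-enters-from-parent [] _ (inj₂ b→a ∷ inj₂ z→b ∷ _) =
    inj₁ (ℕ.<-trans (depth-parent z→b) (depth-parent b→a))
  ascending-or-enters-from-parent (c ∷ ws) ((_ ∷ z∉) ∷ a∉ ∷ uniq) (a~b ∷ edges)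
    with ascending-or-enters-from-parent ws (z∉ ∷ uniq) edges
  ... | inj₂ (p , p∈ , p→z) = inj₂ (p , there p∈ , p→z)
  ... | inj₁ z<b with a~b | edges | a∉
  ...   | inj₂ b→a | _ | _ = inj₁ (ℕ.<-trans z<b (depth-parent b→a))
  ...   | inj₁ a→b | inj₂ c→b ∷ _ | _ ∷ a≢c ∷ _ =
    contradiction (unique-parent a→b c→b) a≢c
  ...   | inj₁ a→b | inj₁ b→c ∷ _ | _ =
    contradiction z<b (ℕ.<-asym (descending-walk ws (z∉ ∷ uniq) edges b→c))

  no-cycle : ∀ u v w ws → Unique (u ∷ v ∷ w ∷ ws) →
    ¬ Linked TreeEdge (u ∷ v ∷ w ∷ ws ++ [ u ])
  no-cycle u v w ws ((_ ∷ u≢w ∷ _) ∷ _) (inj₁ u→v ∷ inj₂ w→v ∷ _) =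
    u≢w (unique-parent u→v w→v)
  no-cycle u v w ws uniq (inj₁ u→v ∷ edges@(inj₁ v→w ∷ _)) =
    ℕ.<-asym (depth-parent u→v) (descending-walk ws uniq edges v→w)
  no-cycle u v w ws uniq@(_ ∷ v∉ ∷ _) (inj₂ v→u ∷ edges)
    with ascending-or-enters-from-parent ws uniq edges
  ... | inj₁ u<v            = ℕ.<-asym (depth-parent v→u) u<v
  ... | inj₂ (p , p∈ , p→u) = All.lookup v∉ p∈ (unique-parent v→u p→u)

record SpanningTree {n} (G : Graph n) : Set₁ where
  field
    tree     : Graph n
    isTree   : IsTree tree
    spanning : V tree ≡ V G
    Adj-tree : ∀ {u v} → Adj tree u v → Adj G u v

Star-∈V : ∀ {n} (G : Graph n) {u v} → u ∈ V G → Star (Adj G) u v → v ∈ V G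
Star-∈V G u∈ ε        = u∈
Star-∈V G u∈ (e ◅ es) = Star-∈V G (Adj⇒∈V G (Adj-sym G e)) es

-- Breadth-first spanning trees of connected graphs.

module BreadthFirst {n} (G : Graph n) {r} (r∈V : r ∈ V G) (connected : Connected G) where

  -- There is a walk from `r` to `v` with exactly `k` edges. The least such `k` is the distance of
  -- `v` from `r`.
  Within : ℕ → Fin n → Set
  Within zero    v = v ≡ r
  Within (suc k) v = ∃[ u ] Within k u × Adj G u v

  within? : ∀ k → U.Decidable (Within k)
  within? zero    v = v ≟ r
  within? (suc k) v = any? λ u → within? k u ×-dec Adj? G u v

  within-∈V : ∀ k {v} → Within k v → v ∈ V G
  within-∈V zero    refl        = r∈V
  within-∈V (suc k) (_ , _ , e) = Adj⇒∈V G (Adj-sym G e)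

  walk-within : ∀ {k u v} → Within k u → Star (Adj G) u v → ∃[ l ] Within l v
  walk-within p ε        = _ , p
  walk-within p (e ◅ es) = walk-within (_ , p , e) es

  nearest : ∀ {v} → v ∈ V G → ∃[ j ] Within j v × (∀ {i} → Within i v → j ℕ.≤ i)
  nearest {v} v∈ =
    least (λ k → within? k v) (proj₂ (walk-within {zero} refl (connected r∈V v∈)))

  depth : Fin n → ℕ
  depth v with v ∈? V G
  ... | yes v∈ = proj₁ (nearest v∈)
  -- A default value outside the graph; `depth-spec` is restricted to `V G`.
  ... | no  _  = 0

  depth-spec : ∀ {v} → v ∈ V G →
    Within (depth v) v × (∀ {i} → Within i v → depth v ℕ.≤ i)
  depth-spec {v} v∈ with v ∈? V G
  ... | yes v∈′ = proj₂ (nearest v∈′)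
  ... | no  v∉  = contradiction v∈ v∉

  CloserNeighbour : Fin n → Fin n → Set
  CloserNeighbour v u = Adj G u v × depth u ℕ.< depth v

  closer? : ∀ v → Dec (∃ (CloserNeighbour v))
  closer? v = any? λ u → Adj? G u v ×-dec (depth u ℕ.<? depth v)

  -- The last vertex before `v` on a shortest walk of length `suc k` is itself reached in `k` steps,
  -- so its depth is at most `k`.
  root-or-closer : ∀ {v} → v ∈ V G → v ≡ r ⊎ ∃ (CloserNeighbour v)
  root-or-closer {v} v∈ with depth v in eq | depth-spec v∈
  ... | zero  | v≡r , _ = inj₁ v≡r
  ... | suc k | (u , p , e) , _ =
    inj₂ (u , e , ℕ.s≤s (proj₂ (depth-spec (within-∈V k p)) p))

  parent : Fin n → Maybe (Fin n)
  parent v with closer? v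
  ... | yes (u , _) = just u
  -- This happens only at the root and outside `V G`, by `root-or-closer`.
  ... | no  _       = nothing

  parent-closer : ∀ {u v} → parent v ≡ just u → CloserNeighbour v u
  parent-closer {v = v} eq with closer? v
  parent-closer refl | yes (_ , closer) = closer

  root-or-parent : ∀ {v} → v ∈ V G → v ≡ r ⊎ ∃[ u ] parent v ≡ just u
  root-or-parent {v} v∈ with closer? v
  ... | yes (u , _) = inj₂ (u , refl)
  ... | no  none with root-or-closer v∈
  ...   | inj₁ v≡r    = inj₁ v≡r
  ...   | inj₂ closer = contradiction closer none

  open ParentFunction parent depth (proj₂ ∘ parent-closer)

  edge-Adj : ∀ {u v} → TreeEdge u v → Adj G u v
  edge-Adj (inj₁ p) = proj₁ (parent-closer p)
  edge-Adj (inj₂ p) = Adj-sym G (proj₁ (parent-closer p))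

  tree : Graph n
  tree = record
    { V          = V G
    ; Adj        = TreeEdge
    ; Adj?       = λ u v → ≡-dec _≟_ (parent v) (just u) ⊎-dec ≡-dec _≟_ (parent u) (just v)
    ; Adj-sym    = swap
    ; Adj-irrefl = λ u≡v → Adj-irrefl G u≡v ∘ edge-Adj
    ; Adj⇒∈V     = Adj⇒∈V G ∘ edge-Adj
    }

  -- The number `k` is fuel: depth strictly drops on passing to the parent, so the recursion runs on
  -- a strict upper bound for the depth.
  climb : ∀ k {v} → v ∈ V G → depth v ℕ.< k → Star TreeEdge v r
  climb (suc k) {v} v∈ (ℕ.s≤s d≤k) with root-or-parent v∈
  ... | inj₁ refl    = ε
  ... | inj₂ (u , p) with parent-closer p
  ...   | e , d<d′ = inj₂ p ◅ climb k (Adj⇒∈V G e) (ℕ.<-≤-trans d<d′ d≤k)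

  tree-connected : Connected tree
  tree-connected u∈ v∈ =
    climb _ u∈ ℕ.≤-refl ◅◅ reverse swap (climb _ v∈ ℕ.≤-refl)

  spanningTree : SpanningTree G
  spanningTree = record
    { tree     = tree
    ; isTree   = record
      { nonempty = r , r∈V ; connected = tree-connected ; acyclic = no-cycle }
    ; spanning = refl
    ; Adj-tree = edge-Adj
    }

toColor : Bool → Fin 2
toColor = Inverse.from 2↔Bool

toColor-injective : ∀ {a b} → toColor a ≡ toColor b → a ≡ b
toColor-injective {false} {false} _ = refl
toColor-injective {true}  {true}  _ = refl

-- Odd expansions from disjoint trees

module TreesToOddExpansion {n t} (G : Graph n) (side : Fin n → Bool) (T : Fin t → Graph n)
  (trees : ∀ s → IsTree (T s))
  (owner-unique : ∀ {s s′ v} → v ∈ V (T s) → v ∈ V (T s′) → s ≡ s′)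
  (V⊆ : ∀ s {v} → v ∈ V (T s) → v ∈ V G)
  (Adj⊆ : ∀ s {u v} → Adj (T s) u v → Adj G u v)
  (bichromatic : ∀ s {u v} → Adj (T s) u v → side u ≢ side v)
  (links : ∀ {s s′} → s ≢ s′ →
    ∃[ u ] ∃[ v ] u ∈ V (T s) × v ∈ V (T s′) × Adj G u v × side u ≡ side v)
  where

  link : Fin t → Fin t → Fin n × Fin n
  link s s′ with s ≟ s′
  -- A default on the diagonal, where `link-spec` claims nothing; non-emptiness of the tree supplies
  -- a vertex.
  ... | yes _    = proj₁ (IsTree.nonempty (trees s)) , proj₁ (IsTree.nonempty (trees s))
  ... | no  s≢s′ = proj₁ (links s≢s′) , proj₁ (proj₂ (links s≢s′))

  IsLink : Fin t → Fin t → Rel (Fin n) 0ℓ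
  IsLink s s′ u v = u ∈ V (T s) × v ∈ V (T s′) × Adj G u v × side u ≡ side v

  link-spec : ∀ {s s′} → s ≢ s′ → IsLink s s′ (proj₁ (link s s′)) (proj₂ (link s s′))
  link-spec {s} {s′} s≢s′ with s ≟ s′
  ... | yes s≡s′ = contradiction s≡s′ s≢s′
  ... | no  s≢s′ = proj₂ (proj₂ (links s≢s′))

  -- Only s < s′ is used, so that each pair of trees gets a single edge.
  Linking : Fin t → Fin t → Rel (Fin n) 0ℓ
  Linking s s′ u v = s < s′ × link s s′ ≡ (u , v)

  linking? : ∀ s s′ u v → Dec (Linking s s′ u v)
  linking? s s′ u v = (s <? s′) ×-dec ×-≡-dec _≟_ _≟_ (link s s′) (u , v)

  <⇒≢ : ∀ {s s′ : Fin t} → s < s′ → s ≢ s′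
  <⇒≢ s<s′ refl = ℕ.<-irrefl refl s<s′

  linking-spec : ∀ {s s′ u v} → Linking s s′ u v → IsLink s s′ u v
  linking-spec (s<s′ , refl) = link-spec (<⇒≢ s<s′)

  HAdj : Rel (Fin n) 0ℓ
  HAdj u v = (∃[ s ] Adj (T s) u v) ⊎
             (∃[ s ] ∃[ s′ ] (Linking s s′ u v ⊎ Linking s s′ v u))

  HAdj-sym : ∀ {u v} → HAdj u v → HAdj v u
  HAdj-sym (inj₁ (s , e))      = inj₁ (s , Adj-sym (T s) e)
  HAdj-sym (inj₂ (s , s′ , l)) = inj₂ (s , s′ , swap l)

  HAdj⇒Adj : ∀ {u v} → HAdj u v → Adj G u v
  HAdj⇒Adj (inj₁ (s , e)) = Adj⊆ s e
  HAdj⇒Adj (inj₂ (s , s′ , inj₁ l)) with linking-spec l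
  ... | _ , _ , e , _ = e
  HAdj⇒Adj (inj₂ (s , s′ , inj₂ l)) with linking-spec l
  ... | _ , _ , e , _ = Adj-sym G e

  owned? : U.Decidable λ v → ∃[ s ] v ∈ V (T s)
  owned? v = any? λ s → v ∈? V (T s)

  HAdj-owned : ∀ {u v} → HAdj u v → ∃[ s ] u ∈ V (T s)
  HAdj-owned (inj₁ (s , e)) = s , Adj⇒∈V (T s) e
  HAdj-owned (inj₂ (s , s′ , inj₁ l)) = s , proj₁ (linking-spec l)
  HAdj-owned (inj₂ (s , s′ , inj₂ l)) = s′ , proj₁ (proj₂ (linking-spec l))

  H : Graph n
  H = record
    { V          = subset owned?
    ; Adj        = HAdj
    ; Adj?       = λ u v → any? (λ s → Adj? (T s) u v) ⊎-dec
                     any? (λ s → any? λ s′ → linking? s s′ u v ⊎-dec linking? s s′ v u)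
    ; Adj-sym    = HAdj-sym
    ; Adj-irrefl = λ u≡v → Adj-irrefl G u≡v ∘ HAdj⇒Adj
    ; Adj⇒∈V     = ∈-subset⁺ owned? ∘ HAdj-owned
    }

  -- An edge of a tree has both ends in that tree, which `owner-unique` forbids here. A link has its
  -- ends in the two trees it was chosen for, so `owner-unique` identifies these with `s` and `s′`,
  -- in one order or the other.
  crossing : ∀ {s s′ u v} → s ≢ s′ → u ∈ V (T s) → v ∈ V (T s′) → HAdj u v →
             Linking s s′ u v ⊎ Linking s′ s v u
  crossing s≢s′ u∈ v∈ (inj₁ (a , e)) = contradiction
    (trans (owner-unique u∈ (Adj⇒∈V (T a) e))
           (owner-unique (Adj⇒∈V (T a) (Adj-sym (T a) e)) v∈)) s≢s′
  crossing s≢s′ u∈ v∈ (inj₂ (a , b , inj₁ l)) with linking-spec l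
  ... | u∈′ , v∈′ , _ with owner-unique u∈ u∈′ | owner-unique v∈ v∈′
  ...   | refl | refl = inj₁ l
  crossing s≢s′ u∈ v∈ (inj₂ (a , b , inj₂ l)) with linking-spec l
  ... | v∈′ , u∈′ , _ with owner-unique u∈ u∈′ | owner-unique v∈ v∈′
  ...   | refl | refl = inj₂ l

  crossing-monochromatic : ∀ {s s′ u v} → s ≢ s′ → u ∈ V (T s) → v ∈ V (T s′) →
                           HAdj u v → side u ≡ side v
  crossing-monochromatic s≢s′ u∈ v∈ e with crossing s≢s′ u∈ v∈ e
  ... | inj₁ l = proj₂ (proj₂ (proj₂ (linking-spec l)))
  ... | inj₂ l = sym (proj₂ (proj₂ (proj₂ (linking-spec l))))

  crossing-exists : ∀ {s s′} → s ≢ s′ →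
    ∃[ u ] ∃[ v ] u ∈ V (T s) × v ∈ V (T s′) × HAdj u v
  crossing-exists {s} {s′} s≢s′ with <-cmp s s′
  ... | tri≈ _ s≡s′ _ = contradiction s≡s′ s≢s′
  ... | tri< s<s′ _ _ with linking-spec (s<s′ , refl)
  ...   | u∈ , v∈ , _ = _ , _ , u∈ , v∈ , inj₂ (_ , _ , inj₁ (s<s′ , refl))
  crossing-exists {s} {s′} s≢s′ | tri> _ _ s′<s with linking-spec (s′<s , refl)
  ...   | u∈ , v∈ , _ = _ , _ , v∈ , u∈ , inj₂ (_ , _ , inj₂ (s′<s , refl))

  -- Both edges are the link of the same ordered pair, because `s < s′` and `s′ < s` exclude each
  -- other, and `link` is a function of that pair.
  crossing-unique : ∀ {s s′ u v u′ v′} → s ≢ s′ →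
    u ∈ V (T s) → v ∈ V (T s′) → HAdj u v →
    u′ ∈ V (T s) → v′ ∈ V (T s′) → HAdj u′ v′ → (u , v) ≡ (u′ , v′)
  crossing-unique s≢s′ u∈ v∈ e u′∈ v′∈ e′
    with crossing s≢s′ u∈ v∈ e | crossing s≢s′ u′∈ v′∈ e′
  ... | inj₁ (_ , p)  | inj₁ (_ , p′) = trans (sym p) p′
  ... | inj₁ (lt , _) | inj₂ (gt , _) = contradiction gt (ℕ.<-asym lt)
  ... | inj₂ (gt , _) | inj₁ (lt , _) = contradiction gt (ℕ.<-asym lt)
  ... | inj₂ (_ , p)  | inj₂ (_ , p′) with trans (sym p) p′
  ...   | refl = refl

  H-isExpansion : IsExpansion t H T
  H-isExpansion = record
    { trees           = trees
    ; disjoint        = λ {s} {s′} s≢s′ (v , v∈) →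
        let v∈s , v∈s′ = x∈p∩q⁻ (V (T s)) (V (T s′)) v∈ in s≢s′ (owner-unique v∈s v∈s′)
    ; subgraphs       = λ s → (λ v∈ → ∈-subset⁺ owned? (s , v∈)) , λ e → inj₁ (s , e)
    ; connectingEdge  = λ s≢s′ →
        let u , v , u∈ , v∈ , e = crossing-exists s≢s′ in
        (u , v) , (u∈ , v∈ , e) ,
        λ { (u′∈ , v′∈ , e′) → crossing-unique s≢s′ u∈ v∈ e u′∈ v′∈ e′ }
    ; noOtherVertices = ∈-subset⁻ owned?
    ; noOtherEdges    = λ
        { (inj₁ e) → inj₁ e
        ; (inj₂ (s , s′ , inj₁ l)) → let u∈ , v∈ , _ = linking-spec l in
            inj₂ (s , s′ , <⇒≢ (proj₁ l) , u∈ , v∈)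
        ; (inj₂ (s , s′ , inj₂ l)) → let v∈ , u∈ , _ = linking-spec l in
            inj₂ (s′ , s , ≢-sym (<⇒≢ (proj₁ l)) , u∈ , v∈) }
    }

  hasOddMinor : HasOddMinor t G
  hasOddMinor = H , (V-H⊆V-G , HAdj⇒Adj) , T , record
    { isExpansion   = H-isExpansion
    ; color         = λ (v , _) → toColor (side v)
    ; bichromatic   = λ s u v e → bichromatic s e ∘ toColor-injective
    ; monochromatic = λ s≢s′ u v u∈ v∈ e →
        cong toColor (crossing-monochromatic s≢s′ u∈ v∈ e)
    }
    where
    V-H⊆V-G : ∀ {v} → v ∈ V H → v ∈ V G
    V-H⊆V-G v∈ = let s , v∈s = ∈-subset⁻ owned? v∈ in V⊆ s v∈s

-- Partitions into connected bipartite classes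

module _ {n} (G : Graph n) where

  InClass : ∀ {m} → (Fin n → Fin m) → Rel (Fin n) 0ℓ
  InClass class u v = Adj G u v × class u ≡ class v

  -- The values of class and side outside V G are junk.
  record BipartitePartition (m : ℕ) : Set where
    field
      class           : Fin n → Fin m
      side            : Fin n → Bool
      side-proper     : ∀ {u v} → Adj G u v → class u ≡ class v → side u ≢ side v
      class-connected : ∀ {u v} → u ∈ V G → v ∈ V G → class u ≡ class v →
                        Star (InClass class) u v

  open BipartitePartition

  singletons : BipartitePartition n
  singletons = record
    { class           = id
    ; side            = const false
    ; side-proper     = λ e u≡v → contradiction e (Adj-irrefl G u≡v)
    ; class-connected = λ { _ _ refl → ε }
    }

  module _ {m} (P : BipartitePartition m) where

    Joined : Rel Bool 0ℓ → Rel (Fin m) 0ℓ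
    Joined R i j = ∃[ u ] ∃[ v ]
      Adj G u v × class P u ≡ i × class P v ≡ j × R (side P u) (side P v)

    joined? : ∀ {R} → Decidable R → Decidable (Joined R)
    joined? R? i j = any? λ u → any? λ v →
      Adj? G u v ×-dec (class P u ≟ i) ×-dec (class P v ≟ j) ×-dec R? (side P u) (side P v)

    BothWays : Rel (Fin m) 0ℓ
    BothWays i j = Joined _≡_ i j × Joined _≢_ i j

    bothWays? : Decidable BothWays
    bothWays? i j = joined? _≟ᵇ_ i j ×-dec joined? (λ a b → ¬? (a ≟ᵇ b)) i j

    Saturated : Set
    Saturated = ∀ {u v} → Adj G u v → class P u ≢ class P v →
                BothWays (class P u) (class P v)

    Mergeable : Rel (Fin n) 0ℓ
    Mergeable u v = Adj G u v × class P u ≢ class P v × ¬ BothWays (class P u) (class P v)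

    mergeable? : Decidable Mergeable
    mergeable? u v = Adj? G u v ×-dec ¬? (class P u ≟ class P v) ×-dec
                     ¬? (bothWays? (class P u) (class P v))

    -- Complementing the sides on one whole class keeps them proper inside every class, and
    -- exchanges monochromatic and bichromatic among the edges that leave this class.
    flip : Fin m → BipartitePartition m
    flip i = record
      { class = class P ; side = flipped
      ; side-proper = λ {u} {v} → proper {u} {v} ; class-connected = class-connected P }
      where
      flipped : Fin n → Bool
      flipped v = if does (class P v ≟ i) then not (side P v) else side P v

      proper : ∀ {u v} → Adj G u v → class P u ≡ class P v → flipped u ≢ flipped v
      proper {u} {v} e u≡v with class P u ≟ i | class P v ≟ i
      ... | yes _   | yes _   = side-proper P e u≡v ∘ not-injective
      ... | no  _   | no  _   = side-proper P e u≡v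
      ... | yes u≡i | no  v≢i = contradiction (trans (sym u≡v) u≡i) v≢i
      ... | no  u≢i | yes v≡i = contradiction (trans u≡v v≡i) u≢i

    flip-same : ∀ {i v} → class P v ≡ i → side (flip i) v ≡ not (side P v)
    flip-same {i} {v} v≡i with class P v ≟ i
    ... | yes _   = refl
    ... | no  v≢i = contradiction v≡i v≢i

    flip-other : ∀ {i v} → class P v ≢ i → side (flip i) v ≡ side P v
    flip-other {i} {v} v≢i with class P v ≟ i
    ... | yes v≡i = contradiction v≡i v≢i
    ... | no  _   = refl

  -- Merging two adjacent classes without monochromatic edges between them.

  module Merge {m} (P : BipartitePartition (suc m)) {a b} (a~b : Adj G a b)
    (a≁b : class P a ≢ class P b) (¬mono : ¬ Joined P _≡_ (class P a) (class P b)) where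

    i j : Fin (suc m)
    i = class P a
    j = class P b

    redirect : Fin (suc m) → Fin (suc m)
    redirect k = if does (k ≟ j) then i else k

    j≢redirect : ∀ k → j ≢ redirect k
    j≢redirect k with k ≟ j
    ... | yes _   = ≢-sym a≁b
    ... | no  k≢j = ≢-sym k≢j

    -- Once `j` is redirected to `i`, no class has index `j`, and `punchOut` closes the gap. The
    -- drop from `suc m` to `m` is what makes `saturate` terminate.
    merge : Fin (suc m) → Fin m
    merge k = punchOut (j≢redirect k)

    -- Since `punchOut` is injective, any identification comes from `redirect`, which identifies
    -- only `i` with `j`.
    merge-≡ : ∀ {k l} → merge k ≡ merge l →
              k ≡ l ⊎ (k ≡ i × l ≡ j) ⊎ (k ≡ j × l ≡ i)
    merge-≡ {k} {l} eq
      with punchOut-injective (j≢redirect k) (j≢redirect l) eq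
    ... | eq′ with k ≟ j | l ≟ j
    ...   | yes k≡j | yes l≡j = inj₁ (trans k≡j (sym l≡j))
    ...   | yes k≡j | no  _   = inj₂ (inj₂ (k≡j , sym eq′))
    ...   | no  _   | yes l≡j = inj₂ (inj₁ (eq′ , l≡j))
    ...   | no  _   | no  _   = inj₁ eq′

    merge-ij : merge i ≡ merge j
    merge-ij = punchOut-cong j redirect-ij
      where
      redirect-ij : redirect i ≡ redirect j
      redirect-ij rewrite dec-false (i ≟ j) a≁b | dec-true (j ≟ j) refl = refl

    newClass : Fin n → Fin m
    newClass = merge ∘ class P

    connect : ∀ {u v} → u ∈ V G → v ∈ V G → class P u ≡ class P v → Star (InClass newClass) u v
    connect u∈ v∈ u≡v =
      mapStar (λ (e , eq) → e , cong merge eq) (class-connected P u∈ v∈ u≡v)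

    -- The edge `a~b` is the bridge: walk to `a` inside the class `i`, cross to `b`, and go on
    -- inside the class `j`.
    across : ∀ {u v} → u ∈ V G → v ∈ V G → class P u ≡ i → class P v ≡ j →
             Star (InClass newClass) u v
    across u∈ v∈ u≡i v≡j =
      connect u∈ (Adj⇒∈V G a~b) u≡i ◅◅ (a~b , merge-ij) ◅
      connect (Adj⇒∈V G (Adj-sym G a~b)) v∈ (sym v≡j)

    merged : BipartitePartition m
    merged = record
      { class = newClass ; side = side P
      ; side-proper = λ {u} {v} → proper {u} {v}
      ; class-connected = connected }
      where
      proper : ∀ {u v} → Adj G u v → newClass u ≡ newClass v → side P u ≢ side P v
      proper e eq u≡v with merge-≡ eq
      ... | inj₁ same               = side-proper P e same u≡v
      ... | inj₂ (inj₁ (u≡i , v≡j)) = ¬mono (_ , _ , e , u≡i , v≡j , u≡v)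
      ... | inj₂ (inj₂ (u≡j , v≡i)) = ¬mono (_ , _ , Adj-sym G e , v≡i , u≡j , sym u≡v)

      connected : ∀ {u v} → u ∈ V G → v ∈ V G → newClass u ≡ newClass v →
                  Star (InClass newClass) u v
      connected u∈ v∈ eq with merge-≡ eq
      ... | inj₁ same               = connect u∈ v∈ same
      ... | inj₂ (inj₁ (u≡i , v≡j)) = across u∈ v∈ u≡i v≡j
      ... | inj₂ (inj₂ (u≡j , v≡i)) =
        reverse (λ (e , eq) → Adj-sym G e , sym eq) (across v∈ u∈ v≡i u≡j)

  shrink : ∀ {m} (P : BipartitePartition (suc m)) {u v} → Mergeable P u v →
           BipartitePartition m
  shrink P {u} {v} (e , u≁v , ¬both) with joined? P _≟ᵇ_ (class P u) (class P v)
  ... | no  ¬mono = Merge.merged P e u≁v ¬mono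
  ... | yes mono  = Merge.merged (flip P (class P u)) e u≁v
    -- An edge that is monochromatic after the flip was bichromatic before it. Together with `mono`
    -- it would join the classes both ways.
    λ (x , y , x~y , x≡u , y≡v , same) → ¬both (mono , x , y , x~y , x≡u , y≡v ,
      λ eq → not-¬ (sym eq) (sym (trans (sym (flip-same P x≡u))
        (trans same (flip-other P λ y≡u → u≁v (trans (sym y≡u) y≡v))))))

  -- Recursion on the number of class indices, which `shrink` lowers by one.
  saturate : ∀ {m} → BipartitePartition m → ∃[ l ] Σ[ P ∈ BipartitePartition l ] Saturated P
  saturate {m} P with any? (λ u → any? (mergeable? P u))
  saturate {suc m} P | yes (u , v , uv) = saturate (shrink P uv)
  saturate {zero}  P | yes (u , _) with () ← class P u
  saturate {m}     P | no  none = m , P , λ {u} {v} e u≁v →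
    decidable-stable (bothWays? P (class P u) (class P v))
      λ ¬both → none (u , v , e , u≁v , ¬both)

  -- The contracted graph and its colourings.

  module Contraction {m} (P : BipartitePartition m) where

    -- Some indices may be hit by no vertex of `G`: `singletons` has an index for every element of
    -- `Fin n`, also outside `V G`. Such indices must not become vertices of the contracted graph.
    inhabited? : U.Decidable λ i → ∃[ v ] v ∈ V G × class P v ≡ i
    inhabited? i = any? λ v → (v ∈? V G) ×-dec (class P v ≟ i)

    ContractedAdj : Rel (Fin m) 0ℓ
    ContractedAdj i j = i ≢ j × ∃[ u ] ∃[ v ] Adj G u v × class P u ≡ i × class P v ≡ j

    contracted : Graph m
    contracted = record
      { V          = subset inhabited?
      ; Adj        = ContractedAdj
      ; Adj?       = λ i j → ¬? (i ≟ j) ×-dec any? λ u → any? λ v →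
                       Adj? G u v ×-dec (class P u ≟ i) ×-dec (class P v ≟ j)
      ; Adj-sym    = λ (i≢j , u , v , e , u≡i , v≡j) →
                       ≢-sym i≢j , v , u , Adj-sym G e , v≡j , u≡i
      ; Adj-irrefl = λ i≡j (i≢j , _) → i≢j i≡j
      ; Adj⇒∈V     = λ (_ , u , _ , e , u≡i , _) →
                       ∈-subset⁺ inhabited? (u , Adj⇒∈V G e , u≡i)
      }

    -- The ends of an edge inside a class differ in `side`; the ends of an edge between classes
    -- differ in the colour of their class.
    lift-coloring : ∀ {f} → Colorable f contracted → Colorable (+ 2 * f) G
    lift-coloring {f} (k , k≤f , c , c-proper) =
      2 ℕ.* k , subst (_≤ᶻ + 2 * f) (sym (pos-* 2 k)) (*-monoˡ-≤-nonNeg (+ 2) k≤f) ,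
      color , proper
      where
      vertex : Vertex G → Vertex contracted
      vertex (v , v∈) = class P v , ∈-subset⁺ inhabited? (v , v∈ , refl)

      color : Vertex G → Fin (2 ℕ.* k)
      color v = combine (toColor (side P (proj₁ v))) (c (vertex v))

      proper : Proper G color
      proper u v e eq
        with combine-injective (toColor (side P (proj₁ u))) (c (vertex u)) _ _ eq
           | class P (proj₁ u) ≟ class P (proj₁ v)
      ... | sides , _      | yes same = side-proper P e same (toColor-injective sides)
      ... | _     , colors | no  u≁v  =
        c-proper (vertex u) (vertex v) (u≁v , _ , _ , e , refl , refl) colors

    -- Lifting minors of the contracted graph to odd minors.

    InPreimage : Subset m → Fin n → Set
    InPreimage S v = v ∈ V G × class P v ∈ S

    inPreimage? : ∀ S → U.Decidable (InPreimage S)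
    inPreimage? S v = (v ∈? V G) ×-dec (class P v ∈? S)

    BichromaticIn : Subset m → Rel (Fin n) 0ℓ
    BichromaticIn S u v = Adj G u v × side P u ≢ side P v × class P u ∈ S × class P v ∈ S

    -- All bichromatic edges among the classes in `S` are kept, so cycles may occur. Only
    -- connectedness has to be shown: any spanning tree then has bichromatic edges only.
    bichromaticPreimage : Subset m → Graph n
    bichromaticPreimage S = record
      { V          = subset (inPreimage? S)
      ; Adj        = BichromaticIn S
      ; Adj?       = λ u v → Adj? G u v ×-dec ¬? (side P u ≟ᵇ side P v) ×-dec
                       (class P u ∈? S) ×-dec (class P v ∈? S)
      ; Adj-sym    = λ (e , u≢v , u∈ , v∈) → Adj-sym G e , ≢-sym u≢v , v∈ , u∈
      ; Adj-irrefl = λ u≡v → Adj-irrefl G u≡v ∘ proj₁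
      ; Adj⇒∈V     = λ (e , _ , u∈ , _) → ∈-subset⁺ (inPreimage? S) (Adj⇒∈V G e , u∈)
      }

    -- Edges inside a class are bichromatic because `side` is proper there.
    lift-class-walk : ∀ S {u v} → class P u ∈ S → Star (InClass (class P)) u v →
                      Star (BichromaticIn S) u v
    lift-class-walk S u∈ ε = ε
    lift-class-walk S u∈ ((e , same) ◅ es) =
      (e , side-proper P e same , u∈ , w∈) ◅ lift-class-walk S w∈ es
      where w∈ = subst (_∈ S) same u∈

    module _ (saturated : Saturated P) where

      both-ways : ∀ {i j} → ContractedAdj i j → BothWays P i j
      both-ways (i≢j , _ , _ , e , refl , refl) = saturated e i≢j

      -- Each edge of the walk in `T` is replaced by a bichromatic edge between the two classes,
      -- supplied by saturation. Walks inside the classes connect the end of one such edge to the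
      -- start of the next.
      lift-walk : ∀ (T : Graph m) → (∀ {i j} → Adj T i j → ContractedAdj i j) →
        ∀ {i j u v} → Star (Adj T) i j → i ∈ V T → u ∈ V G → class P u ≡ i →
        v ∈ V G → class P v ≡ j → Star (BichromaticIn (V T)) u v
      lift-walk T T⊆ ε i∈ u∈ refl v∈ v≡j =
        lift-class-walk (V T) i∈ (class-connected P u∈ v∈ (sym v≡j))
      lift-walk T T⊆ (i~k ◅ es) i∈ u∈ refl v∈ v≡j with proj₂ (both-ways (T⊆ i~k))
      ... | x , y , e , x≡i , refl , x≢y =
        lift-class-walk (V T) i∈ (class-connected P u∈ (Adj⇒∈V G e) (sym x≡i)) ◅◅
        (e , x≢y , subst (_∈ V T) (sym x≡i) i∈ , k∈) ◅
        lift-walk T T⊆ es k∈ (Adj⇒∈V G (Adj-sym G e)) refl v∈ v≡j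
        where k∈ = Adj⇒∈V T (Adj-sym T i~k)

      lift-minor : ∀ {t} → HasMinor t contracted → HasOddMinor t G
      lift-minor {t} (H , (VH⊆ , AdjH⊆) , T , expansion) =
        TreesToOddExpansion.hasOddMinor G (side P) (SpanningTree.tree ∘ lifted)
          (SpanningTree.isTree ∘ lifted) owner-unique
          (λ s → proj₁ ∘ ∈-tree⁻ s)
          (λ s → proj₁ ∘ SpanningTree.Adj-tree (lifted s))
          (λ s → proj₁ ∘ proj₂ ∘ SpanningTree.Adj-tree (lifted s))
          links
        where
        open IsExpansion expansion

        T⊆ : ∀ s {i j} → Adj (T s) i j → ContractedAdj i j
        T⊆ s = AdjH⊆ ∘ proj₂ (subgraphs s)

        lifted : ∀ s → SpanningTree (bichromaticPreimage (V (T s)))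
        lifted s with IsTree.nonempty (trees s)
        -- The root is a vertex of some class in `T s`; it exists because vertices of the contracted
        -- graph are inhabited classes.
        ... | i , i∈ with ∈-subset⁻ inhabited? (VH⊆ (proj₁ (subgraphs s) i∈))
        ...   | r , r∈ , refl = BreadthFirst.spanningTree (bichromaticPreimage (V (T s)))
          (∈-subset⁺ (inPreimage? (V (T s))) (r∈ , i∈)) connected
          where
          connected : Connected (bichromaticPreimage (V (T s)))
          connected u∈ v∈ =
            let u∈G , u∈T = ∈-subset⁻ (inPreimage? (V (T s))) u∈
                v∈G , v∈T = ∈-subset⁻ (inPreimage? (V (T s))) v∈
            in lift-walk (T s) (T⊆ s) (IsTree.connected (trees s) u∈T v∈T) u∈T u∈G refl v∈G refl

        ∈-tree⁻ : ∀ s {v} → v ∈ V (SpanningTree.tree (lifted s)) → InPreimage (V (T s)) v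
        ∈-tree⁻ s v∈ = ∈-subset⁻ (inPreimage? (V (T s)))
          (subst (_ ∈_) (SpanningTree.spanning (lifted s)) v∈)

        ∈-tree⁺ : ∀ s {v} → InPreimage (V (T s)) v → v ∈ V (SpanningTree.tree (lifted s))
        ∈-tree⁺ s v∈ = subst (_ ∈_) (sym (SpanningTree.spanning (lifted s)))
          (∈-subset⁺ (inPreimage? (V (T s))) v∈)

        owner-unique : ∀ {s s′ v} → v ∈ V (SpanningTree.tree (lifted s)) →
                       v ∈ V (SpanningTree.tree (lifted s′)) → s ≡ s′
        owner-unique {s} {s′} v∈ v∈′ = decidable-stable (s ≟ s′) λ s≢s′ →
          disjoint s≢s′ (_ , x∈p∩q⁺ (proj₂ (∈-tree⁻ s v∈) , proj₂ (∈-tree⁻ s′ v∈′)))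

        links : ∀ {s s′} → s ≢ s′ → ∃[ u ] ∃[ v ]
          u ∈ V (SpanningTree.tree (lifted s)) × v ∈ V (SpanningTree.tree (lifted s′)) ×
          Adj G u v × side P u ≡ side P v
        links {s} {s′} s≢s′ with connectingEdge s≢s′
        -- The monochromatic half of saturation is used here, the bichromatic half in `lift-walk`.
        -- The ends of the edge lie in the classes `i` and `j`, hence in the two lifted trees.
        ... | (i , j) , (i∈ , j∈ , i~j) , _ with proj₁ (both-ways (AdjH⊆ i~j))
        ...   | u , v , e , refl , refl , same = u , v ,
          ∈-tree⁺ s (Adj⇒∈V G e , i∈) , ∈-tree⁺ s′ (Adj⇒∈V G (Adj-sym G e) , j∈) , e , same

theorem2 : (t : ℕ) (f : ℤ) →
    (∀ {n : ℕ} (G : Graph n) → ¬ HasMinor t G → Colorable f G) →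
    ∀ {n : ℕ} (G : Graph n) → ¬ HasOddMinor t G → Colorable (+ 2 * f) G
theorem2 t f hadwiger G ¬odd with saturate G (singletons G)
... | _ , P , saturated = lift-coloring {f} (hadwiger contracted (¬odd ∘ lift-minor saturated))
  where open Contraction G P
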